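{- There exists a tree $T_0$ with $n$ vertices such that every monotone drawing of $T_0$ must use an $\Omega(n)\times\Omega(n)$ grid. That is, there exist constants $\gamma>0$ and $n_0$ such that for every $n\ge n_0$ there is a tree $T_0$ with $n$ vertices such that, in every monotone drawing of $T_0$ whose vertices are placed at points with integer coordinates, the bounding box of the drawing has both width at least $\gamma n$ and height at least $\gamma n$.
   Context: A straight-line drawing of a tree $T$ assigns to its vertices distinct points of the plane and draws each edge as the line segment connecting the points of its two end vertices, without any edge crossing. A path $P=(u_1,\dots,u_k)$ in a straight-line drawing is monotone with respect to a direction $l$ (a half-line, equivalently a nonzero vector) if the orthogonal projections of $u_1,\dots,u_k$ on $l$ appear along $l$ in the (strict) order in which they appear along the path; $P$ is monotone if it is monotone with respect to some direction. A straight-line drawing of $T$ is a monotone drawing if for every pair of vertices $u,w$ the path of $T$ between $u$ and $w$ is monotone (the direction may depend on the pair). A drawing on a grid is one whose vertices are placed at points with integer coordinates. -}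

module Defs where

open import Data.Fin.Base using (Fin)
open import Data.Integer.Base as ℤ using (ℤ; +_)
import Data.Integer.Properties as ℤₚ
open import Data.List.Base using (List; []; _∷_; length; map; allFin)
open import Data.List.Extrema ℤₚ.≤-totalOrder using (max; min)
open import Data.List.Relation.Unary.AllPairs using (AllPairs)
open import Data.List.Relation.Unary.Unique.Propositional using (Unique)
open import Data.Nat.Base as ℕ using (ℕ)
import Data.Nat.Properties as ℕₚ
open import Data.Product.Base using (∃; ∃-syntax; _×_; _,_; proj₁; proj₂)
open import Data.Rational.Base as ℚ using (ℚ; 0ℚ; 1ℚ; ½; 1/_)
import Data.Rational.Literals as ℚ
import Data.Rational.Properties as ℚₚ
open import Data.Rational.Solver using (module +-*-Solver)
open import Data.Sum.Base using (_⊎_)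
open import Function.Base using (_∘_)
open import Level using (0ℓ)
open import Relation.Binary.Core using (Rel)
open import Relation.Binary.Construct.Closure.ReflexiveTransitive
  using (Star; ε; _◅_)
open import Relation.Binary.Definitions using (Decidable; Irreflexive; Symmetric)
open import Relation.Binary.PropositionalEquality
  using (_≡_; _≢_; refl; sym; cong; subst; module ≡-Reasoning)
open import Relation.Nullary.Decidable.Core using (dec⇒maybe)
open import Relation.Nullary.Negation using (¬_)
open import Tactic.RingSolver using (solve-∀)
open import Tactic.RingSolver.Core.AlmostCommutativeRing
  using (AlmostCommutativeRing; fromCommutativeRing)

private
  dist : ℚ → ℚ → ℚ
  dist p q = ℚ.∣ p ℚ.- q ∣

IsCauchy : (ℕ → ℚ) → Set
IsCauchy x = ∀ δ → 0ℚ ℚ.< δ →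
  ∃[ N ] (∀ m n → N ℕ.≤ m → N ℕ.≤ n → ℚ.∣ x m ℚ.- x n ∣ ℚ.< δ)

-- Real numbers are Cauchy sequences of rationals; equality is _≈_ below.
record ℝ : Set where
  constructor mkℝ
  field
    seq    : ℕ → ℚ
    cauchy : IsCauchy seq

open ℝ public

private
  half-pos : ∀ {δ} → 0ℚ ℚ.< δ → 0ℚ ℚ.< ½ ℚ.* δ
  half-pos = ℚₚ.*-monoʳ-<-pos ½

  const-cauchy : ∀ q → IsCauchy (λ _ → q)
  const-cauchy q δ δ>0 = 0 , λ _ _ _ _ →
    subst (ℚ._< δ) (sym (cong ℚ.∣_∣ (ℚₚ.+-inverseʳ q))) δ>0

  neg-cauchy : ∀ x → IsCauchy x → IsCauchy (ℚ.-_ ∘ x)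
  neg-cauchy x cx δ δ>0 with cx δ δ>0
  ... | N , h = N , λ m n N≤m N≤n → subst (ℚ._< δ) (eq m n) (h m n N≤m N≤n)
    where
    open ≡-Reasoning
    open +-*-Solver
    eq : ∀ m n → dist (x m) (x n) ≡ dist (ℚ.- x m) (ℚ.- x n)
    eq m n = begin
      ℚ.∣ x m ℚ.- x n ∣            ≡⟨ ℚₚ.∣-p∣≡∣p∣ (x m ℚ.- x n) ⟨
      ℚ.∣ ℚ.- (x m ℚ.- x n) ∣      ≡⟨ cong ℚ.∣_∣ (solve 2 (λ a b →
                                        :- (a :- b) := (:- a) :- (:- b))
                                        refl (x m) (x n)) ⟩
      ℚ.∣ ℚ.- x m ℚ.- ℚ.- x n ∣    ∎

  +-cauchy : ∀ x y → IsCauchy x → IsCauchy y → IsCauchy (λ n → x n ℚ.+ y n)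
  +-cauchy x y cx cy δ δ>0
    with cx (½ ℚ.* δ) (half-pos δ>0) | cy (½ ℚ.* δ) (half-pos δ>0)
  ... | N , h | M , k = N ℕ.⊔ M , λ m n p q → begin-strict
    ℚ.∣ (x m ℚ.+ y m) ℚ.- (x n ℚ.+ y n) ∣
      ≡⟨ cong ℚ.∣_∣ (solve 4 (λ a b c d →
           (a :+ b) :- (c :+ d) := (a :- c) :+ (b :- d))
           refl (x m) (y m) (x n) (y n)) ⟩
    ℚ.∣ (x m ℚ.- x n) ℚ.+ (y m ℚ.- y n) ∣
      ≤⟨ ℚₚ.∣p+q∣≤∣p∣+∣q∣ (x m ℚ.- x n) (y m ℚ.- y n) ⟩
    dist (x m) (x n) ℚ.+ dist (y m) (y n)
      <⟨ ℚₚ.+-mono-< (h m n (ℕₚ.m⊔n≤o⇒m≤o N M p) (ℕₚ.m⊔n≤o⇒m≤o N M q))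
                     (k m n (ℕₚ.m⊔n≤o⇒n≤o N M p) (ℕₚ.m⊔n≤o⇒n≤o N M q)) ⟩
    ½ ℚ.* δ ℚ.+ ½ ℚ.* δ
      ≡⟨ solve 1 (λ d → con ½ :* d :+ con ½ :* d := d) refl δ ⟩
    δ ∎
    where
    open ℚₚ.≤-Reasoning
    open +-*-Solver

  bounded : ∀ x → IsCauchy x →
            ∃[ N ] ∃[ B ] 0ℚ ℚ.< B × (∀ n → N ℕ.≤ n → ℚ.∣ x n ∣ ℚ.≤ B)
  bounded x cx with cx 1ℚ (ℚₚ.positive⁻¹ 1ℚ)
  ... | N , h = N , ℚ.∣ x N ∣ ℚ.+ 1ℚ
              , ℚₚ.+-mono-≤-< (ℚₚ.0≤∣p∣ (x N)) (ℚₚ.positive⁻¹ 1ℚ)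
              , λ n N≤n → begin
    ℚ.∣ x n ∣
      ≡⟨ cong ℚ.∣_∣ (solve 2 (λ a b → a := b :+ (a :- b)) refl (x n) (x N)) ⟩
    ℚ.∣ x N ℚ.+ (x n ℚ.- x N) ∣
      ≤⟨ ℚₚ.∣p+q∣≤∣p∣+∣q∣ (x N) (x n ℚ.- x N) ⟩
    ℚ.∣ x N ∣ ℚ.+ dist (x n) (x N)
      ≤⟨ ℚₚ.+-monoʳ-≤ ℚ.∣ x N ∣ (ℚₚ.<⇒≤ (h n N N≤n ℕₚ.≤-refl)) ⟩
    ℚ.∣ x N ∣ ℚ.+ 1ℚ ∎
    where
    open ℚₚ.≤-Reasoning
    open +-*-Solver

  ℚ-ring : AlmostCommutativeRing 0ℓ 0ℓ
  ℚ-ring = fromCommutativeRing ℚₚ.+-*-commutativeRing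
                               (λ p → dec⇒maybe (0ℚ ℚₚ.≟ p))

  *-difference : ∀ a b c d →
    a ℚ.* b ℚ.- c ℚ.* d ≡ a ℚ.* (b ℚ.- d) ℚ.+ d ℚ.* (a ℚ.- c)
  *-difference = solve-∀ ℚ-ring

  *-bound : ∀ a b B δ → 0ℚ ℚ.< B → ℚ.∣ a ∣ ℚ.≤ B → ℚ.∣ b ∣ ℚ.< δ →
            ℚ.∣ a ℚ.* b ∣ ℚ.< B ℚ.* δ
  *-bound a b B δ B>0 ha hb = begin-strict
    ℚ.∣ a ℚ.* b ∣          ≡⟨ ℚₚ.∣p*q∣≡∣p∣*∣q∣ a b ⟩
    ℚ.∣ a ∣ ℚ.* ℚ.∣ b ∣    ≤⟨ ℚₚ.*-monoʳ-≤-nonNeg ℚ.∣ b ∣ {{ℚₚ.∣-∣-nonNeg b}} ha ⟩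
    B ℚ.* ℚ.∣ b ∣          <⟨ ℚₚ.*-monoʳ-<-pos B {{ℚ.positive B>0}} hb ⟩
    B ℚ.* δ                ∎
    where open ℚₚ.≤-Reasoning

  *-estimate : ∀ a b c d B C η → 0ℚ ℚ.< B → 0ℚ ℚ.< C →
    ℚ.∣ a ∣ ℚ.≤ B → ℚ.∣ d ∣ ℚ.≤ C → dist b d ℚ.< η → dist a c ℚ.< η →
    dist (a ℚ.* b) (c ℚ.* d) ℚ.< (B ℚ.+ C) ℚ.* η
  *-estimate a b c d B C η B>0 C>0 a≤B d≤C b-d a-c = begin-strict
    dist (a ℚ.* b) (c ℚ.* d)
      ≡⟨ cong ℚ.∣_∣ (*-difference a b c d) ⟩
    ℚ.∣ a ℚ.* (b ℚ.- d) ℚ.+ d ℚ.* (a ℚ.- c) ∣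
      ≤⟨ ℚₚ.∣p+q∣≤∣p∣+∣q∣ (a ℚ.* (b ℚ.- d)) (d ℚ.* (a ℚ.- c)) ⟩
    ℚ.∣ a ℚ.* (b ℚ.- d) ∣ ℚ.+ ℚ.∣ d ℚ.* (a ℚ.- c) ∣
      <⟨ ℚₚ.+-mono-< (*-bound a (b ℚ.- d) B η B>0 a≤B b-d)
                     (*-bound d (a ℚ.- c) C η C>0 d≤C a-c) ⟩
    B ℚ.* η ℚ.+ C ℚ.* η
      ≡⟨ ℚₚ.*-distribʳ-+ η B C ⟨
    (B ℚ.+ C) ℚ.* η ∎
    where open ℚₚ.≤-Reasoning

  divide : ∀ D δ → 0ℚ ℚ.< D → 0ℚ ℚ.< δ → ∃[ η ] 0ℚ ℚ.< η × D ℚ.* η ≡ δ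
  divide D δ D>0 δ>0 = 1/ D ℚ.* δ , η>0 , Dη≡δ
    where
    instance
      D-pos : ℚ.Positive D
      D-pos = ℚ.positive D>0
      D-nonZero : ℚ.NonZero D
      D-nonZero = ℚₚ.pos⇒nonZero D
      1/D-pos : ℚ.Positive (1/ D)
      1/D-pos = ℚₚ.1/pos⇒pos D
    η>0 : 0ℚ ℚ.< 1/ D ℚ.* δ
    η>0 = subst (ℚ._< 1/ D ℚ.* δ) (ℚₚ.*-zeroʳ (1/ D))
                (ℚₚ.*-monoʳ-<-pos (1/ D) δ>0)
    Dη≡δ : D ℚ.* (1/ D ℚ.* δ) ≡ δ
    Dη≡δ = begin
      D ℚ.* (1/ D ℚ.* δ)   ≡⟨ ℚₚ.*-assoc D (1/ D) δ ⟨
      (D ℚ.* 1/ D) ℚ.* δ   ≡⟨ cong (ℚ._* δ) (ℚₚ.*-inverseʳ D) ⟩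
      1ℚ ℚ.* δ             ≡⟨ ℚₚ.*-identityˡ δ ⟩
      δ                    ∎
      where open ≡-Reasoning

  *-cauchy : ∀ x y → IsCauchy x → IsCauchy y → IsCauchy (λ n → x n ℚ.* y n)
  *-cauchy x y cx cy δ δ>0 = bounds (bounded x cx) (bounded y cy)
    where
    Goal : Set
    Goal = ∃[ N ] (∀ m n → N ℕ.≤ m → N ℕ.≤ n →
             dist (x m ℚ.* y m) (x n ℚ.* y n) ℚ.< δ)

    module _ N₁ B (B>0 : 0ℚ ℚ.< B) (hB : ∀ n → N₁ ℕ.≤ n → ℚ.∣ x n ∣ ℚ.≤ B)
             N₂ C (C>0 : 0ℚ ℚ.< C) (hC : ∀ n → N₂ ℕ.≤ n → ℚ.∣ y n ∣ ℚ.≤ C)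
             η (Dη≡δ : (B ℚ.+ C) ℚ.* η ≡ δ) where

      combine : ∃[ N ] (∀ m n → N ℕ.≤ m → N ℕ.≤ n → dist (x m) (x n) ℚ.< η) →
                ∃[ N ] (∀ m n → N ℕ.≤ m → N ℕ.≤ n → dist (y m) (y n) ℚ.< η) →
                Goal
      combine (N₃ , h) (N₄ , k) = (N₁ ℕ.⊔ N₂) ℕ.⊔ (N₃ ℕ.⊔ N₄) , λ m n p q →
        let p₁₂ = ℕₚ.m⊔n≤o⇒m≤o (N₁ ℕ.⊔ N₂) (N₃ ℕ.⊔ N₄) p
            q₁₂ = ℕₚ.m⊔n≤o⇒m≤o (N₁ ℕ.⊔ N₂) (N₃ ℕ.⊔ N₄) q
            p₃₄ = ℕₚ.m⊔n≤o⇒n≤o (N₁ ℕ.⊔ N₂) (N₃ ℕ.⊔ N₄) p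
            q₃₄ = ℕₚ.m⊔n≤o⇒n≤o (N₁ ℕ.⊔ N₂) (N₃ ℕ.⊔ N₄) q
        in subst (dist (x m ℚ.* y m) (x n ℚ.* y n) ℚ.<_) Dη≡δ
             (*-estimate (x m) (y m) (x n) (y n) B C η B>0 C>0
               (hB m (ℕₚ.m⊔n≤o⇒m≤o N₁ N₂ p₁₂)) (hC n (ℕₚ.m⊔n≤o⇒n≤o N₁ N₂ q₁₂))
               (k m n (ℕₚ.m⊔n≤o⇒n≤o N₃ N₄ p₃₄) (ℕₚ.m⊔n≤o⇒n≤o N₃ N₄ q₃₄))
               (h m n (ℕₚ.m⊔n≤o⇒m≤o N₃ N₄ p₃₄) (ℕₚ.m⊔n≤o⇒m≤o N₃ N₄ q₃₄)))

    bounds : ∃[ N ] ∃[ B ] 0ℚ ℚ.< B × (∀ n → N ℕ.≤ n → ℚ.∣ x n ∣ ℚ.≤ B) →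
             ∃[ N ] ∃[ C ] 0ℚ ℚ.< C × (∀ n → N ℕ.≤ n → ℚ.∣ y n ∣ ℚ.≤ C) →
             Goal
    bounds (N₁ , B , B>0 , hB) (N₂ , C , C>0 , hC) =
      finish (divide (B ℚ.+ C) δ (ℚₚ.+-mono-< {0ℚ} {B} {0ℚ} {C} B>0 C>0) δ>0)
      where
      finish : ∃[ η ] 0ℚ ℚ.< η × (B ℚ.+ C) ℚ.* η ≡ δ → Goal
      finish (η , η>0 , Dη≡δ) =
        combine N₁ B B>0 hB N₂ C C>0 hC η Dη≡δ (cx η η>0) (cy η η>0)

fromℚ : ℚ → ℝ
fromℚ q = mkℝ (λ _ → q) (const-cauchy q)

fromℤ : ℤ → ℝ
fromℤ z = fromℚ (ℚ.fromℤ z)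

0ℝ 1ℝ : ℝ
0ℝ = fromℚ 0ℚ
1ℝ = fromℚ 1ℚ

infix  8 -_
infixl 7 _*_
infixl 6 _+_ _-_
infix  4 _≤_ _<_ _≈_

_+_ _*_ : ℝ → ℝ → ℝ
x + y = mkℝ (λ n → seq x n ℚ.+ seq y n) (+-cauchy (seq x) (seq y) (cauchy x) (cauchy y))
x * y = mkℝ (λ n → seq x n ℚ.* seq y n) (*-cauchy (seq x) (seq y) (cauchy x) (cauchy y))

-_ : ℝ → ℝ
- x = mkℝ (λ n → ℚ.- seq x n) (neg-cauchy (seq x) (cauchy x))

_-_ : ℝ → ℝ → ℝ
x - y = x + (- y)

_<_ _≤_ _≈_ : Rel ℝ 0ℓ
x < y = ∃[ δ ] 0ℚ ℚ.< δ × ∃[ N ] (∀ n → N ℕ.≤ n → seq x n ℚ.+ δ ℚ.≤ seq y n)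
x ≤ y = ∀ δ → 0ℚ ℚ.< δ → ∃[ N ] (∀ n → N ℕ.≤ n → seq x n ℚ.≤ seq y n ℚ.+ δ)
x ≈ y = x ≤ y × y ≤ x

ℝ² : Set
ℝ² = ℝ × ℝ

infix 4 _≈²_
_≈²_ : Rel ℝ² 0ℓ
(a , b) ≈² (c , d) = a ≈ c × b ≈ d

OnSegment : ℝ² → ℝ² → ℝ² → Set
OnSegment (a , b) (c , d) q = ∃[ t ] 0ℝ ≤ t × t ≤ 1ℝ ×
  q ≈² ((1ℝ - t) * a + t * c , (1ℝ - t) * b + t * d)

-- The position along l of the orthogonal projection of q on l is this
-- inner product divided by the norm of l, which does not affect order.
projection : ℝ² → ℝ² → ℝ
projection (l₁ , l₂) (a , b) = l₁ * a + l₂ * b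

record Graph (n : ℕ) : Set₁ where
  infix 4 _~_ _~?_
  field
    _~_      : Rel (Fin n) 0ℓ
    _~?_     : Decidable _~_
    ~-sym    : Symmetric _~_
    ~-irrefl : Irreflexive _≡_ _~_

  Walk : Rel (Fin n) 0ℓ
  Walk = Star _~_

  vertices : ∀ {u v} → Walk u v → List (Fin n)
  vertices {u} ε       = u ∷ []
  vertices {u} (_ ◅ w) = u ∷ vertices w

  IsPath : ∀ {u v} → Walk u v → Set
  IsPath w = Unique (vertices w)

  Connected : Set
  Connected = ∀ u v → Walk u v

  -- A cycle is a path on at least three vertices whose ends are adjacent.
  Acyclic : Set
  Acyclic = ∀ {u v} (w : Walk u v) → IsPath w → 3 ℕ.≤ length (vertices w) →
            ¬ (v ~ u)

record Tree (n : ℕ) : Set₁ where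
  field
    graph     : Graph n
    nonempty  : ℕ.NonZero n
    connected : Graph.Connected graph
    acyclic   : Graph.Acyclic graph

  open Graph graph public

module _ {n} (T : Tree n) (pos : Fin n → ℝ²) where
  open Tree T

  -- Two different edges share no point of the plane other than the
  -- position of a common end vertex.
  NoCrossing : Set
  NoCrossing = ∀ {a b c d} → a ~ b → c ~ d →
    ¬ ((a ≡ c × b ≡ d) ⊎ (a ≡ d × b ≡ c)) →
    ∀ q → OnSegment (pos a) (pos b) q → OnSegment (pos c) (pos d) q →
    ∃[ v ] (v ≡ a ⊎ v ≡ b) × (v ≡ c ⊎ v ≡ d) × q ≈² pos v

  record IsStraightLineDrawing : Set where
    field
      distinct   : ∀ {u v} → u ≢ v → ¬ (pos u ≈² pos v)
      noCrossing : NoCrossing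

  MonotoneWrt : ℝ² → ∀ {u w} → Walk u w → Set
  MonotoneWrt l P =
    AllPairs (λ x y → projection l (pos x) < projection l (pos y)) (vertices P)

  Monotone : ∀ {u w} → Walk u w → Set
  Monotone P = ∃[ l ] ¬ (l ≈² (0ℝ , 0ℝ)) × MonotoneWrt l P

  -- In a tree there is exactly one path between u and w.
  record IsMonotoneDrawing : Set where
    field
      isStraightLineDrawing : IsStraightLineDrawing
      monotone : ∀ u w (P : Walk u w) → IsPath P → Monotone P

ℤ² : Set
ℤ² = ℤ × ℤ

fromℤ² : ℤ² → ℝ²
fromℤ² (a , b) = fromℤ a , fromℤ b

extent : List ℤ → ℤ
extent []       = + 0
extent (z ∷ zs) = max z zs ℤ.- min z zs

-- The sides of the axis-parallel bounding box of the points pos v.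
width height : ∀ {n} → (Fin n → ℤ²) → ℤ
width  {n} pos = extent (map (proj₁ ∘ pos) (allFin n))
height {n} pos = extent (map (proj₂ ∘ pos) (allFin n))

-- The tree is a spider with three legs of about n/3 edges.  The path from the
-- end of leg i through the centre to the end of leg j is monotone, so some
-- linear functional increases outwards along leg j and decreases outwards along
-- leg i.  If the edges of a leg do not all point strictly right or all strictly
-- left, then a nonnegative combination of at most two of them is a vertical
-- vector (0 , y).  The functionals force the numbers y of two such legs to have
-- opposite signs, which is impossible for three legs.  Hence along some leg the
-- integral abscissa changes by at least 1, in the same direction, at each edge,
-- and the width is at least n/6; the height is treated in the same way.
module Submission where

open import Defs
open import Data.Empty using (⊥-elim)
open import Data.Fin.Base using (Fin; zero; suc; toℕ; fromℕ<)
open import Data.Fin.Patterns using (0F; 1F; 2F)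
import Data.Fin.Properties as Finₚ
open import Data.Integer.Base as ℤ using (ℤ; +_)
import Data.Integer.Properties as ℤₚ
open import Data.List.Base using ([]; _∷_; map; allFin)
open import Data.List.Extrema ℤₚ.≤-totalOrder using (xs≤max; ⊥≤max; min≤xs; min≤⊤)
open import Data.List.Membership.Propositional using (_∈_)
open import Data.List.Membership.Propositional.Properties using (∈-map⁺; ∈-allFin)
open import Data.List.Relation.Unary.All as All using (All; []; _∷_)
open import Data.List.Relation.Unary.AllPairs using (AllPairs; []; _∷_)
open import Data.List.Relation.Unary.Any using (here; there)
open import Data.List.Relation.Unary.Unique.Propositional using (Unique)
open import Data.Nat.Base as ℕ using (ℕ; zero; suc; z≤n; s≤s)
open import Data.Nat.DivMod using (_mod_; m<n⇒m%n≡m; m≡m%n+[m/n]*n; m%n<n; m/n*n≤m; m≥n⇒m/n>0)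
import Data.Nat.Properties as ℕₚ
open import Data.Product.Base using (Σ-syntax; ∃-syntax; _×_; _,_; proj₁; proj₂)
open import Data.Rational.Base as ℚ using (ℚ; 0ℚ)
import Data.Rational.Literals as ℚ
import Data.Rational.Properties as ℚₚ
open import Data.Rational.Solver using (module +-*-Solver)
open import Data.Sum.Base using (_⊎_; inj₁; inj₂; swap; [_,_]′)
open import Function.Base using (_∘_)
open import Relation.Binary.Construct.Closure.ReflexiveTransitive as Star
  using (ε; _◅_; _◅◅_)
open import Relation.Binary.Definitions using (tri<; tri≈; tri>)
open import Relation.Binary.PropositionalEquality
  using (_≡_; _≢_; refl; sym; trans; cong; subst; subst₂)
open import Relation.Nullary.Decidable using (Dec; yes; no; _×-dec_; _⊎-dec_)
open import Relation.Nullary.Negation using (¬_; contradiction)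

-- Trees on initial segments of the naturals, given by a parent function.

module ParentTree (parent : ℕ → ℕ) (parent≤ : ∀ v → parent (suc v) ℕ.≤ v) (k : ℕ) where

  infix 4 _childOf_
  _childOf_ : Fin (suc k) → Fin (suc k) → Set
  c childOf p = 0 ℕ.< toℕ c × toℕ p ≡ parent (toℕ c)

  parent<child : ∀ {c p} → c childOf p → toℕ p ℕ.< toℕ c
  parent<child {suc c} (_ , eq) = s≤s (subst (ℕ._≤ toℕ c) (sym eq) (parent≤ (toℕ c)))

  parent-unique : ∀ {c p q} → c childOf p → c childOf q → p ≡ q
  parent-unique (_ , eq) (_ , eq′) = Finₚ.toℕ-injective (trans eq (sym eq′))

  graph : Graph (suc k)
  graph = record
    { _~_      = λ u v → u childOf v ⊎ v childOf u
    ; _~?_     = λ u v → childOf? u v ⊎-dec childOf? v u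
    ; ~-sym    = swap
    ; ~-irrefl = λ { refl → [ irrefl , irrefl ]′ }
    }
    where
    childOf? : ∀ c p → Dec (c childOf p)
    childOf? c p = (0 ℕₚ.<? toℕ c) ×-dec (toℕ p ℕₚ.≟ parent (toℕ c))
    irrefl : ∀ {v} → ¬ v childOf v
    irrefl e = ℕₚ.<-irrefl refl (parent<child e)

  open Graph graph

  -- The bound `b` is what the recursion descends on, since a parent is not a structural part of its
  -- child.
  toRoot : ∀ b u → toℕ u ℕ.≤ b → Walk u zero
  toRoot b       zero    _         = ε
  toRoot (suc b) (suc u) (s≤s u≤b) = inj₁ e ◅ toRoot b p (subst (ℕ._≤ b) (sym toℕp) p≤b)
    where
    p≤u = parent≤ (toℕ u)
    p≤b = ℕₚ.≤-trans p≤u u≤b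
    p<n = ℕₚ.≤-<-trans p≤u (ℕₚ.m<n⇒m<1+n (Finₚ.toℕ<n u))
    p = fromℕ< p<n
    toℕp : toℕ p ≡ parent (toℕ (suc u))
    toℕp = Finₚ.toℕ-fromℕ< p<n
    e : suc u childOf p
    e = s≤s z≤n , toℕp

  end∈vertices : ∀ {u v} (w : Walk u v) → v ∈ vertices w
  end∈vertices ε       = here refl
  end∈vertices (_ ◅ w) = there (end∈vertices w)

  start∈vertices : ∀ {u v} (w : Walk u v) → u ∈ vertices w
  start∈vertices ε       = here refl
  start∈vertices (_ ◅ _) = here refl

  -- After a step away from the root a path can never step towards it again.
  path-descends : ∀ {p c v} → c childOf p → (w : Walk c v) → All (p ≢_) (vertices w) → IsPath w →
                  c ≡ v ⊎ ∃[ q ] v childOf q × toℕ c ℕ.≤ toℕ q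
  path-descends e ε p∉ uniq = inj₁ refl
  path-descends e (inj₁ up ◅ w) (_ ∷ p∉) uniq =
    contradiction (parent-unique e up) (All.lookup p∉ (start∈vertices w))
  path-descends e (inj₂ down ◅ w) _ (c∉ ∷ uniq) with path-descends down w c∉ uniq
  ... | inj₁ refl           = inj₂ (_ , down , ℕₚ.≤-refl)
  ... | inj₂ (q , e′ , d≤q) = inj₂ (q , e′ , ℕₚ.<⇒≤ (ℕₚ.<-≤-trans (parent<child down) d≤q))

  -- A path that avoids the parent `u` of `v` cannot enter `v` from above. By `path-descends` one
  -- step away from the root would force exactly that, so every step goes towards the root and the
  -- numbers fall.
  path-ascends : ∀ {u x v} → v childOf u → (w : Walk x v) → All (u ≢_) (vertices w) → IsPath w →
                 toℕ v ℕ.≤ toℕ x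
  path-ascends e ε _ _ = ℕₚ.≤-refl
  path-ascends e (step ◅ w) (u≢x ∷ u∉) (x∉ ∷ uniq) with path-ascends e w u∉ uniq | step
  ... | v≤y | inj₁ up   = ℕₚ.≤-trans v≤y (ℕₚ.<⇒≤ (parent<child up))
  ... | v≤y | inj₂ down with path-descends down w x∉ uniq
  ...   | inj₁ refl           = contradiction (parent-unique e down) u≢x
  ...   | inj₂ (q , e′ , y≤q) = contradiction
    (ℕₚ.≤-<-trans (ℕₚ.≤-trans v≤y y≤q) (parent<child e′)) (ℕₚ.<-irrefl refl)

  -- Compare the direction of the first step with that of the closing edge: either two vertices of
  -- the path coincide, or the order of the numbers puts some number strictly below itself.
  acyclic : Acyclic
  acyclic ε _ (s≤s ()) _
  acyclic (_ ◅ ε) _ (s≤s (s≤s ())) _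
  acyclic (inj₁ up ◅ (_ ◅ w)) (_ ∷ (x∉ ∷ _)) _ (inj₂ up′) =
    All.lookup x∉ (end∈vertices w) (parent-unique up up′)
  acyclic (inj₁ up ◅ w) (u∉ ∷ uniq) _ (inj₁ e) = ℕₚ.<-irrefl refl
    (ℕₚ.<-trans (parent<child up) (ℕₚ.<-≤-trans (parent<child e) (path-ascends e w u∉ uniq)))
  acyclic (inj₂ down ◅ w@(_ ◅ w′)) (u∉ ∷ uniq@(x∉ ∷ _)) _ closing
    with path-descends down w u∉ uniq | closing
  ... | inj₁ x≡v | _ = All.lookup x∉ (end∈vertices w′) x≡v
  ... | inj₂ (q , e′ , x≤q) | inj₁ e = ℕₚ.<-irrefl (cong toℕ (parent-unique e e′))
    (ℕₚ.<-≤-trans (parent<child down) x≤q)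
  ... | inj₂ (q , e′ , x≤q) | inj₂ e = ℕₚ.<-irrefl refl
    (ℕₚ.<-trans (parent<child e) (ℕₚ.<-trans (parent<child down) (ℕₚ.≤-<-trans x≤q (parent<child e′))))

  tree : Tree (suc k)
  tree = record
    { graph     = graph
    ; nonempty  = _
    ; connected = λ u v → toRoot _ u ℕₚ.≤-refl ◅◅ Star.reverse swap (toRoot _ v ℕₚ.≤-refl)
    ; acyclic   = acyclic
    }

-- Three polygonal legs in the rational plane.

0<-* : ∀ {p q} → 0ℚ ℚ.< p → 0ℚ ℚ.< q → 0ℚ ℚ.< p ℚ.* q
0<-* {p} {q} p>0 q>0 =
  ℚₚ.positive⁻¹ _ {{ℚₚ.pos*pos⇒pos p {{ℚ.positive p>0}} q {{ℚ.positive q>0}}}}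

0≤-* : ∀ {p q} → 0ℚ ℚ.≤ p → 0ℚ ℚ.≤ q → 0ℚ ℚ.≤ p ℚ.* q
0≤-* {p} {q} p≥0 q≥0 = ℚₚ.nonNegative⁻¹ _
  {{ℚₚ.nonNeg*nonNeg⇒nonNeg p {{ℚ.nonNegative p≥0}} q {{ℚ.nonNegative q≥0}}}}

0≤-square : ∀ p → 0ℚ ℚ.≤ p ℚ.* p
0≤-square p with ℚₚ.≤-total 0ℚ p
... | inj₁ p≥0 = 0≤-* p≥0 p≥0
... | inj₂ p≤0 = subst (0ℚ ℚ.≤_) (solve 1 (λ a → (:- a) :* (:- a) := a :* a) refl p)
  (0≤-* (ℚₚ.neg-antimono-≤ p≤0) (ℚₚ.neg-antimono-≤ p≤0))
  where open +-*-Solver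

p<q⇒0<q-p : ∀ {p q} → p ℚ.< q → 0ℚ ℚ.< q ℚ.- p
p<q⇒0<q-p {p} {q} p<q = subst (ℚ._< q ℚ.- p) (ℚₚ.+-inverseʳ p) (ℚₚ.+-monoˡ-< (ℚ.- p) p<q)

p≤q⇒0≤q-p : ∀ {p q} → p ℚ.≤ q → 0ℚ ℚ.≤ q ℚ.- p
p≤q⇒0≤q-p {p} {q} p≤q = subst (ℚ._≤ q ℚ.- p) (ℚₚ.+-inverseʳ p) (ℚₚ.+-monoˡ-≤ (ℚ.- p) p≤q)

linear : ℚ → ℚ → ℚ → ℚ → ℚ
linear a b x y = a ℚ.* x ℚ.+ b ℚ.* y

linear-swap : ∀ a b x y → linear a b x y ≡ linear b a y x
linear-swap a b x y = ℚₚ.+-comm (a ℚ.* x) (b ℚ.* y)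

module ThreeLegs (m : ℕ) (X Y : Fin 3 → ℕ → ℚ) where

  open +-*-Solver

  Increasing Decreasing : (ℕ → ℚ) → Set
  Increasing f = ∀ {t} → t ℕ.< m → f t ℚ.< f (suc t)
  Decreasing f = ∀ {t} → t ℕ.< m → f (suc t) ℚ.< f t

  along : ℚ → ℚ → Fin 3 → ℕ → ℚ
  along a b r t = linear a b (X r t) (Y r t)

  -- (0 , y) behaves like a nonzero vector of the cone spanned by the edges of leg r.
  Vertical : Fin 3 → ℚ → Set
  Vertical r y = ∀ a b → Increasing (along a b r) → 0ℚ ℚ.< b ℚ.* y

  -- Edge `s` does not go right and edge `t` does not go left, so nonnegative weights cancel their
  -- abscissas. A functional increasing along the leg is positive on the combination, where only its
  -- coefficient `b` matters.
  vertical : ∀ r {s t} → s ℕ.< m → t ℕ.< m → X r (suc s) ℚ.≤ X r s → X r t ℚ.≤ X r (suc t) →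
             ∃[ y ] Vertical r y
  vertical r {s} {t} s<m t<m xs xt with ℚₚ.<-cmp (X r (suc s)) (X r s)
  ... | tri> _ _ x> = ⊥-elim (ℚₚ.<-irrefl refl (ℚₚ.<-≤-trans x> xs))
  -- Edge `s` is itself vertical. This case stands apart because both weights of the next one could
  -- vanish here.
  ... | tri≈ _ x≡ _ = Y r (suc s) ℚ.- Y r s , λ a b inc →
    subst (0ℚ ℚ.<_)
      (trans (cong (λ x → linear a b x (Y r (suc s)) ℚ.- along a b r s) x≡)
        (solve 5 (λ a b x y y′ → (a :* x :+ b :* y′) :- (a :* x :+ b :* y) := b :* (y′ :- y))
          refl a b (X r s) (Y r s) (Y r (suc s))))
      (p<q⇒0<q-p (inc s<m))
  -- Each edge is weighted by the horizontal length of the other; the weight of edge `t` is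
  -- positive, which makes the inequality strict.
  ... | tri< x< _ _ = (X r (suc t) ℚ.- X r t) ℚ.* (Y r (suc s) ℚ.- Y r s)
                      ℚ.+ (X r s ℚ.- X r (suc s)) ℚ.* (Y r (suc t) ℚ.- Y r t) , λ a b inc →
    subst (0ℚ ℚ.<_)
      (solve 10 (λ a b x x′ u u′ y y′ v v′ →
          (u′ :- u) :* ((a :* x′ :+ b :* y′) :- (a :* x :+ b :* y))
            :+ (x :- x′) :* ((a :* u′ :+ b :* v′) :- (a :* u :+ b :* v))
          := b :* ((u′ :- u) :* (y′ :- y) :+ (x :- x′) :* (v′ :- v)))
        refl a b (X r s) (X r (suc s)) (X r t) (X r (suc t))
                 (Y r s) (Y r (suc s)) (Y r t) (Y r (suc t)))
      (ℚₚ.+-mono-≤-< (0≤-* (p≤q⇒0≤q-p xt) (ℚₚ.<⇒≤ (p<q⇒0<q-p (inc s<m))))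
                     (0<-* (p<q⇒0<q-p x<) (p<q⇒0<q-p (inc t<m))))

  classify : ∀ r → (Increasing (X r) ⊎ Decreasing (X r)) ⊎ ∃[ y ] Vertical r y
  classify r with ℕₚ.anyUpTo? (λ t → X r (suc t) ℚₚ.≤? X r t) m
                | ℕₚ.anyUpTo? (λ t → X r t ℚₚ.≤? X r (suc t)) m
  ... | no ∄ | _    = inj₁ (inj₁ (λ t<m → ℚₚ.≰⇒> (λ x≤ → ∄ (_ , t<m , x≤))))
  ... | _    | no ∄ = inj₁ (inj₂ (λ t<m → ℚₚ.≰⇒> (λ x≤ → ∄ (_ , t<m , x≤))))
  ... | yes (_ , s<m , xs) | yes (_ , t<m , xt) = inj₂ (vertical r s<m t<m xs xt)

  Separated : Fin 3 → Fin 3 → Set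
  Separated i j = ∃[ a ] ∃[ b ] Decreasing (along a b i) × Increasing (along a b j)

  -- The negated functional increases along leg `i`, so `- b` times `y` and `b` times `z` are both
  -- positive.
  vertical-opposite : ∀ {i j y z} → Separated i j → Vertical i y → Vertical j z → y ℚ.* z ℚ.< 0ℚ
  vertical-opposite {i} {j} {y} {z} (a , b , dec , inc) vᵢ vⱼ = ℚₚ.≰⇒> λ yz≥0 →
    ℚₚ.<-irrefl
      (solve 3 (λ b y z → con 0ℚ := (:- b :* y) :* (b :* z) :+ (b :* b) :* (y :* z)) refl b y z)
      (ℚₚ.+-mono-<-≤ (0<-* (vᵢ (ℚ.- a) (ℚ.- b) dec′) (vⱼ a b inc)) (0≤-* (0≤-square b) yz≥0))
    where
    negate : ∀ t → ℚ.- along a b i t ≡ along (ℚ.- a) (ℚ.- b) i t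
    negate t = solve 4 (λ a b x y → :- (a :* x :+ b :* y) := (:- a) :* x :+ (:- b) :* y)
      refl a b (X i t) (Y i t)
    dec′ : Increasing (along (ℚ.- a) (ℚ.- b) i)
    dec′ {t} t<m = subst₂ ℚ._<_ (negate t) (negate (suc t)) (ℚₚ.neg-antimono-< (dec t<m))

  -- The product of `x * y` and `x * z` is the square of `x` times `y * z`: the first form would be
  -- positive, the second at most zero.
  not-all-opposite : ∀ x y z → x ℚ.* y ℚ.< 0ℚ → x ℚ.* z ℚ.< 0ℚ → ¬ y ℚ.* z ℚ.< 0ℚ
  not-all-opposite x y z xy<0 xz<0 yz<0 = ℚₚ.<-irrefl
    (solve 3 (λ x y z → con 0ℚ := (:- (x :* y)) :* (:- (x :* z)) :+ (x :* x) :* (:- (y :* z)))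
      refl x y z)
    (ℚₚ.+-mono-<-≤ (0<-* (ℚₚ.neg-antimono-< xy<0) (ℚₚ.neg-antimono-< xz<0))
                   (0≤-* (0≤-square x) (ℚₚ.<⇒≤ (ℚₚ.neg-antimono-< yz<0))))

  some-leg-monotone : (∀ i j → i ≢ j → Separated i j) →
                      ∃[ r ] (Increasing (X r) ⊎ Decreasing (X r))
  some-leg-monotone sep with classify 0F | classify 1F | classify 2F
  ... | inj₁ mono | _ | _ = 0F , mono
  ... | _ | inj₁ mono | _ = 1F , mono
  ... | _ | _ | inj₁ mono = 2F , mono
  ... | inj₂ (x , vx) | inj₂ (y , vy) | inj₂ (z , vz) = ⊥-elim (not-all-opposite x y z
    (vertical-opposite (sep 0F 1F λ ()) vx vy)
    (vertical-opposite (sep 0F 2F λ ()) vx vz)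
    (vertical-opposite (sep 1F 2F λ ()) vy vz))

-- From real to rational inequalities; extents of integer lists.

eventually-All : ∀ {A : Set} (f : A → ℝ) u xs → All (λ v → f u < f v) xs →
  ∃[ N ] (∀ n → N ℕ.≤ n → All (λ v → seq (f u) n ℚ.< seq (f v) n) xs)
eventually-All f u []       []           = 0 , λ _ _ → []
eventually-All f u (x ∷ xs) ((δ , δ>0 , M , h) ∷ rest) with eventually-All f u xs rest
... | N , ih = M ℕ.⊔ N , λ n p →
  ℚₚ.<-≤-trans (subst (ℚ._< seq (f u) n ℚ.+ δ) (ℚₚ.+-identityʳ _) (ℚₚ.+-monoʳ-< (seq (f u) n) δ>0))
               (h n (ℕₚ.m⊔n≤o⇒m≤o M N p))
  ∷ ih n (ℕₚ.m⊔n≤o⇒n≤o M N p)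

-- A strict inequality of reals holds termwise from some index on, and finitely many share such an
-- index. A real direction can thus be replaced by one of its rational approximations.
eventually-AllPairs : ∀ {A : Set} (f : A → ℝ) xs → AllPairs (λ u v → f u < f v) xs →
  ∃[ N ] (∀ n → N ℕ.≤ n → AllPairs (λ u v → seq (f u) n ℚ.< seq (f v) n) xs)
eventually-AllPairs f []       []           = 0 , λ _ _ → []
eventually-AllPairs f (x ∷ xs) (px ∷ pxs) with eventually-All f x xs px | eventually-AllPairs f xs pxs
... | M , h | N , ih = M ℕ.⊔ N , λ n p →
  h n (ℕₚ.m⊔n≤o⇒m≤o M N p) ∷ ih n (ℕₚ.m⊔n≤o⇒n≤o M N p)

extent-spread : ∀ {zs z w} → z ∈ zs → w ∈ zs → w ℤ.- z ℤ.≤ extent zs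
extent-spread {x ∷ xs} z∈ w∈ =
  ℤₚ.+-mono-≤ (All.lookup (⊥≤max x xs ∷ xs≤max x xs) w∈)
              (ℤₚ.neg-mono-≤ (All.lookup (min≤⊤ x xs ∷ min≤xs x xs) z∈))

fromℤ-cancel-< : ∀ {z w} → ℚ.fromℤ z ℚ.< ℚ.fromℤ w → z ℤ.< w
fromℤ-cancel-< {z} {w} (ℚ.*<* h) = subst₂ ℤ._<_ (ℤₚ.*-identityʳ z) (ℤₚ.*-identityʳ w) h

fromℤ-mono-≤ : ∀ {z w} → z ℤ.≤ w → ℚ.fromℤ z ℚ.≤ ℚ.fromℤ w
fromℤ-mono-≤ {z} {w} z≤w =
  ℚ.*≤* (subst₂ ℤ._≤_ (sym (ℤₚ.*-identityʳ z)) (sym (ℤₚ.*-identityʳ w)) z≤w)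

climb-≤ : ∀ (f : ℕ → ℤ) m → (∀ {t} → t ℕ.< m → f t ℤ.< f (suc t)) → + m ℤ.≤ f m ℤ.- f 0
climb-≤ f zero    inc = ℤₚ.≤-reflexive (sym (ℤₚ.+-inverseʳ (f 0)))
climb-≤ f (suc m) inc = ℤₚ.≤-trans
  (ℤₚ.+-monoʳ-≤ (+ 1) (climb-≤ f m (λ t<m → inc (ℕₚ.m<n⇒m<1+n t<m))))
  (ℤₚ.≤-trans (ℤₚ.≤-reflexive (sym (ℤₚ.+-assoc (+ 1) (f m) (ℤ.- f 0))))
              (ℤₚ.+-monoˡ-≤ (ℤ.- f 0) (ℤₚ.i<j⇒suc[i]≤j (inc ℕₚ.≤-refl))))

-- The spider and the paths between the ends of its legs.

-- With 0 as the centre, leg r (for r = 0, 1, 2) consists of the numbers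
-- r + 1, r + 4, r + 7, …; the parent of v is v ∸ 3, truncated to 0 for v ≤ 3.
module Spider (k : ℕ) where

  open ParentTree (ℕ._∸ 3) (λ v → ℕₚ.m∸n≤m v 2) k public
  open Graph graph

  number : ℕ → ℕ → ℕ
  number r zero    = 0
  number r (suc t) = t ℕ.* 3 ℕ.+ suc r

  number-< : ∀ r t → number r t ℕ.< number r (suc t)
  number-< r zero    = s≤s z≤n
  number-< r (suc t) = ℕₚ.m<n+m (number r (suc t)) {3} (s≤s z≤n)

  number-mono : ∀ r s {t} → s ℕ.≤′ t → number r s ℕ.≤ number r t
  number-mono r s ℕ.≤′-refl               = ℕₚ.≤-refl
  number-mono r s (ℕ.≤′-step {n = t} s≤t) = ℕₚ.≤-trans (number-mono r s s≤t) (ℕₚ.<⇒≤ (number-< r t))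

  number-≤ : ∀ (r : Fin 3) t → number (toℕ r) t ℕ.≤ t ℕ.* 3
  number-≤ r zero    = z≤n
  number-≤ r (suc t) = subst (number (toℕ r) (suc t) ℕ.≤_) (ℕₚ.+-comm (t ℕ.* 3) 3)
                         (ℕₚ.+-monoʳ-≤ (t ℕ.* 3) (Finₚ.toℕ<n r))

  number-parent : ∀ (r : Fin 3) t → number (toℕ r) t ≡ number (toℕ r) (suc t) ℕ.∸ 3
  number-parent r zero    = sym (ℕₚ.m≤n⇒m∸n≡0 (Finₚ.toℕ<n r))
  number-parent r (suc t) = refl

  number-> : ∀ r t (i : Fin 3) → suc (toℕ i) ℕ.< number r (suc (suc t))
  number-> r t i = ℕₚ.≤-<-trans (Finₚ.toℕ<n i) (ℕₚ.m<m+n 3 (ℕₚ.≤-<-trans z≤n (number-< r t)))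

  -- The position `suc s` excludes the shared centre. Subtracting 3 moves both vertices inwards
  -- until one is first on its leg, with number at most 3; the other is then first too, or its
  -- number exceeds 3.
  number-disjoint : ∀ {i j : Fin 3} → i ≢ j → ∀ s t → number (toℕ i) (suc s) ≢ number (toℕ j) t
  number-disjoint i≢j zero    (suc zero) eq = i≢j (Finₚ.toℕ-injective (ℕₚ.suc-injective eq))
  number-disjoint i≢j (suc s) (suc (suc t)) eq =
    number-disjoint i≢j s (suc t) (ℕₚ.+-cancelˡ-≡ 3 _ _ eq)
  number-disjoint {i} {j} i≢j zero    (suc (suc t)) = ℕₚ.<⇒≢ (number-> (toℕ j) t i)
  number-disjoint {i} {j} i≢j (suc s) (suc zero)    = ℕₚ.>⇒≢ (number-> (toℕ i) s j)

  -- The reduction modulo `suc k` makes the function total; by `toℕ-leg` it changes nothing up to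
  -- position `m`.
  leg : Fin 3 → ℕ → Fin (suc k)
  leg r t = number (toℕ r) t mod suc k

  module Legs (m : ℕ) (3m≤k : m ℕ.* 3 ℕ.≤ k) where

    toℕ-leg : ∀ r {t} → t ℕ.≤ m → toℕ (leg r t) ≡ number (toℕ r) t
    toℕ-leg r {t} t≤m = trans (Finₚ.toℕ-fromℕ< _) (m<n⇒m%n≡m (s≤s
      (ℕₚ.≤-trans (number-≤ r t) (ℕₚ.≤-trans (ℕₚ.*-monoˡ-≤ 3 t≤m) 3m≤k))))

    leg-child : ∀ r {t} → t ℕ.< m → leg r (suc t) childOf leg r t
    leg-child r {t} t<m =
      subst (0 ℕ.<_) (sym eq) (ℕₚ.≤-<-trans z≤n (number-< (toℕ r) t)) ,
      trans (toℕ-leg r (ℕₚ.<⇒≤ t<m)) (trans (number-parent r t) (cong (ℕ._∸ 3) (sym eq)))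
      where eq = toℕ-leg r t<m

    descent : ∀ j d {t} → d ℕ.+ t ≡ m → Walk (leg j t) (leg j m)
    descent j zero    refl = ε
    descent j (suc d) {t} eq = inj₂ (leg-child j (subst (t ℕ.<_) eq (s≤s (ℕₚ.m≤n+m t d))))
                               ◅ descent j d (trans (ℕₚ.+-suc d t) eq)

    route : ∀ i j s → s ℕ.≤ m → Walk (leg i s) (leg j m)
    -- `leg i 0` and `leg j 0` are the same vertex by computation, so the path changes legs at the
    -- centre.
    route i j zero    _   = descent j m (ℕₚ.+-identityʳ m)
    route i j (suc s) s<m = inj₁ (leg-child i s<m) ◅ route i j s (ℕₚ.<⇒≤ s<m)

    descent-numbers : ∀ j d {t} (eq : d ℕ.+ t ≡ m) →
      All (λ v → ∃[ u ] t ℕ.≤ u × toℕ v ≡ number (toℕ j) u) (vertices (descent j d eq))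
    descent-numbers j zero refl = (_ , ℕₚ.≤-refl , toℕ-leg j ℕₚ.≤-refl) ∷ []
    descent-numbers j (suc d) {t} eq =
      (t , ℕₚ.≤-refl , toℕ-leg j (subst (t ℕ.≤_) eq (ℕₚ.m≤n+m t (suc d))))
      ∷ All.map (λ { (u , t<u , e) → u , ℕₚ.<⇒≤ t<u , e })
                (descent-numbers j d (trans (ℕₚ.+-suc d t) eq))

    descent-unique : ∀ j d {t} (eq : d ℕ.+ t ≡ m) → Unique (vertices (descent j d eq))
    descent-unique j zero refl = [] ∷ []
    descent-unique j (suc d) {t} eq =
      All.map (λ { (u , t<u , e) refl → ℕₚ.<-irrefl
                   (trans (sym (toℕ-leg j (subst (t ℕ.≤_) eq (ℕₚ.m≤n+m t (suc d))))) e)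
                   (ℕₚ.<-≤-trans (number-< (toℕ j) t) (number-mono (toℕ j) (suc t) (ℕₚ.≤⇒≤′ t<u))) })
              (descent-numbers j d (trans (ℕₚ.+-suc d t) eq))
      ∷ descent-unique j d (trans (ℕₚ.+-suc d t) eq)

    -- Each alternative excludes the vertex that the next longer route puts in front: it has a
    -- larger number on leg `i`, and it does not lie on leg `j`.
    route-numbers : ∀ i j s (s≤m : s ℕ.≤ m) →
      All (λ v → toℕ v ℕ.≤ number (toℕ i) s ⊎ ∃[ u ] toℕ v ≡ number (toℕ j) u)
          (vertices (route i j s s≤m))
    route-numbers i j zero    _   = All.map (λ { (u , _ , e) → inj₂ (u , e) }) (descent-numbers j m _)
    route-numbers i j (suc s) s<m =
      inj₁ (ℕₚ.≤-reflexive (toℕ-leg i s<m))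
      ∷ All.map [ (λ v≤ → inj₁ (ℕₚ.≤-trans v≤ (ℕₚ.<⇒≤ (number-< (toℕ i) s)))) , inj₂ ]′
                (route-numbers i j s (ℕₚ.<⇒≤ s<m))

    route-isPath : ∀ {i j} → i ≢ j → ∀ s (s≤m : s ℕ.≤ m) → IsPath (route i j s s≤m)
    route-isPath {j = j} i≢j zero _ = descent-unique j m _
    route-isPath {i} {j} i≢j (suc s) s<m =
      All.map (λ { (inj₁ v≤) refl → ℕₚ.<⇒≱ (number-< (toℕ i) s)
                     (subst (ℕ._≤ number (toℕ i) s) (toℕ-leg i s<m) v≤)
                 ; (inj₂ (u , e)) refl → number-disjoint i≢j s u (trans (sym (toℕ-leg i s<m)) e) })
              (route-numbers i j s (ℕₚ.<⇒≤ s<m))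
      ∷ route-isPath i≢j s (ℕₚ.<⇒≤ s<m)

    module _ {R : Fin (suc k) → Fin (suc k) → Set} where

      descent-steps : ∀ j d {t} (eq : d ℕ.+ t ≡ m) → AllPairs R (vertices (descent j d eq)) →
        ∀ {u} → t ℕ.≤ u → u ℕ.< m → R (leg j u) (leg j (suc u))
      descent-steps j zero refl _ t≤u u<m = contradiction u<m (ℕₚ.≤⇒≯ t≤u)
      descent-steps j (suc d) {t} eq (rt ∷ rest) {u} t≤u u<m with ℕₚ.m≤n⇒m<n∨m≡n t≤u
      ... | inj₁ t<u  = descent-steps j d (trans (ℕₚ.+-suc d t) eq) rest t<u u<m
      ... | inj₂ refl = All.lookup rt (start∈vertices (descent j d (trans (ℕₚ.+-suc d t) eq)))

      -- Only neighbouring vertices are compared. Leg `i` is traversed inwards, so its pairs come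
      -- out reversed, as `Decreasing` requires.
      route-steps : ∀ i j s (s≤m : s ℕ.≤ m) → AllPairs R (vertices (route i j s s≤m)) →
        (∀ {u} → u ℕ.< s → R (leg i (suc u)) (leg i u)) ×
        (∀ {u} → u ℕ.< m → R (leg j u) (leg j (suc u)))
      route-steps i j zero    _   pairs = (λ ()) , descent-steps j m _ pairs z≤n
      route-steps i j (suc s) s<m (rs ∷ rest) with route-steps i j s (ℕₚ.<⇒≤ s<m) rest
      ... | up , down = (λ u≤s → [ up , (λ { refl → All.lookup rs (start∈vertices (route i j s _)) }) ]′
                                   (ℕₚ.m≤n⇒m<n∨m≡n (ℕₚ.≤-pred u≤s)))
                      , down

    Separated : (x y : Fin (suc k) → ℤ) → Fin 3 → Fin 3 → Set
    Separated x y = ThreeLegs.Separated m (λ r t → ℚ.fromℤ (x (leg r t))) (λ r t → ℚ.fromℤ (y (leg r t)))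

    monotone-separated : ∀ pos → IsMonotoneDrawing tree (fromℤ² ∘ pos) → ∀ {i j} → i ≢ j →
                         Separated (proj₁ ∘ pos) (proj₂ ∘ pos) i j
    monotone-separated pos drawing {i} {j} i≢j =
      freeze (IsMonotoneDrawing.monotone drawing _ _ path (route-isPath i≢j m ℕₚ.≤-refl))
      where
      path = route i j m ℕₚ.≤-refl
      freeze : Monotone tree (fromℤ² ∘ pos) path → Separated (proj₁ ∘ pos) (proj₂ ∘ pos) i j
      freeze ((l₁ , l₂) , _ , pairs) = at (eventually-AllPairs proj (vertices path) pairs)
        where
        proj : Fin (suc k) → ℝ
        proj v = projection (l₁ , l₂) (fromℤ² (pos v))
        at : ∃[ N ] (∀ n → N ℕ.≤ n → AllPairs (λ u v → seq (proj u) n ℚ.< seq (proj v) n) (vertices path)) →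
             Separated (proj₁ ∘ pos) (proj₂ ∘ pos) i j
        -- The coordinates of the vertices are constant sequences, so the `N`th term of a projection
        -- is the rational functional with coefficients `seq l₁ N` and `seq l₂ N`.
        at (N , h) = seq l₁ N , seq l₂ N ,
          route-steps {R = λ u v → seq (proj u) N ℚ.< seq (proj v) N} i j m ℕₚ.≤-refl (h N ℕₚ.≤-refl)

    -- Reflection in the diagonal turns the bound for the width into the one for the height.
    separated-swap : ∀ x y {i j} → Separated x y i j → Separated y x i j
    separated-swap x y (a , b , dec , inc) =
      b , a , (λ t<m → subst₂ ℚ._<_ (linear-swap a b _ _) (linear-swap a b _ _) (dec t<m))
            , (λ t<m → subst₂ ℚ._<_ (linear-swap a b _ _) (linear-swap a b _ _) (inc t<m))

    extent-≥ : ∀ x y → (∀ i j → i ≢ j → Separated x y i j) →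
               + m ℤ.≤ extent (map x (allFin (suc k)))
    extent-≥ x y sep with ThreeLegs.some-leg-monotone m _ _ sep
    ... | r , inj₁ inc = ℤₚ.≤-trans
      (climb-≤ (x ∘ leg r) m (fromℤ-cancel-< ∘ inc))
      (extent-spread (∈-map⁺ x (∈-allFin (leg r 0))) (∈-map⁺ x (∈-allFin (leg r m))))
    -- On a leg with falling coordinate the negated coordinate climbs, and the two ends exchange
    -- their roles in `extent-spread`.
    ... | r , inj₂ dec = ℤₚ.≤-trans
      (climb-≤ (λ t → ℤ.- x (leg r t)) m (λ t<m → ℤₚ.neg-mono-< (fromℤ-cancel-< (dec t<m))))
      (subst (ℤ._≤ _)
        (trans (ℤₚ.+-comm (x (leg r 0)) (ℤ.- x (leg r m)))
               (cong (λ z → ℤ.- x (leg r m) ℤ.+ z) (sym (ℤₚ.neg-involutive (x (leg r 0))))))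
        (extent-spread (∈-map⁺ x (∈-allFin (leg r m))) (∈-map⁺ x (∈-allFin (leg r 0)))))

-- The constant and the conclusion.

⅙ : ℚ
⅙ = + 1 ℚ./ 6

⅙-scale : ∀ {n m w} → n ℕ.≤ 6 ℕ.* m → + m ℤ.≤ w → fromℚ ⅙ * fromℤ (+ n) ≤ fromℤ w
⅙-scale {n} {m} {w} n≤6m m≤w δ δ>0 = 0 , λ _ _ → begin
  ⅙ ℚ.* ℚ.fromℤ (+ n)                    ≤⟨ ℚₚ.*-monoˡ-≤-nonNeg ⅙ n≤6w ⟩
  ⅙ ℚ.* (ℚ.fromℤ (+ 6) ℚ.* ℚ.fromℤ w)    ≡⟨ solve 1 (λ w → con ⅙ :* (con (ℚ.fromℤ (+ 6)) :* w) := w) refl (ℚ.fromℤ w) ⟩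
  ℚ.fromℤ w                              ≡⟨ ℚₚ.+-identityʳ (ℚ.fromℤ w) ⟨
  ℚ.fromℤ w ℚ.+ 0ℚ                       ≤⟨ ℚₚ.+-monoʳ-≤ (ℚ.fromℤ w) (ℚₚ.<⇒≤ δ>0) ⟩
  ℚ.fromℤ w ℚ.+ δ                        ∎
  where
  open ℚₚ.≤-Reasoning
  open +-*-Solver
  n≤6w : ℚ.fromℤ (+ n) ℚ.≤ ℚ.fromℤ (+ 6) ℚ.* ℚ.fromℤ w
  -- The product computes to the fraction of `+ 6 ℤ.* w` over 1, which `↥p/↧p≡p` identifies with an
  -- embedded integer.
  n≤6w = subst (ℚ.fromℤ (+ n) ℚ.≤_) (sym (ℚₚ.↥p/↧p≡p (ℚ.fromℤ (+ 6 ℤ.* w))))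
    (fromℤ-mono-≤ (ℤₚ.≤-trans (ℤ.+≤+ n≤6m) (subst (ℤ._≤ + 6 ℤ.* w) (sym (ℤₚ.pos-* 6 m))
                                             (ℤₚ.*-monoˡ-≤-nonNeg (+ 6) m≤w))))

lemma5 : Σ[ γ ∈ ℝ ] 0ℝ < γ × (Σ[ n₀ ∈ ℕ ] (∀ n → n₀ ℕ.≤ n →
    Σ[ T ∈ Tree n ] (∀ (pos : Fin n → ℤ²) → IsMonotoneDrawing T (fromℤ² ∘ pos) →
    γ * fromℤ (+ n) ≤ fromℤ (width pos) × γ * fromℤ (+ n) ≤ fromℤ (height pos))))
-- Four vertices are the fewest for which every leg has an edge.
lemma5 = fromℚ ⅙ , (⅙ , ℚₚ.positive⁻¹ ⅙ , 0 , λ _ _ → ℚₚ.≤-reflexive (ℚₚ.+-identityˡ ⅙)) , 4 , bound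
  where
  bound : ∀ n → 4 ℕ.≤ n → Σ[ T ∈ Tree n ] (∀ (pos : Fin n → ℤ²) →
    IsMonotoneDrawing T (fromℤ² ∘ pos) →
    fromℚ ⅙ * fromℤ (+ n) ≤ fromℤ (width pos) × fromℚ ⅙ * fromℤ (+ n) ≤ fromℤ (height pos))
  bound (suc k) (s≤s 3≤k) = tree , λ pos drawing →
    ⅙-scale {n = suc k} {m} n≤6m (extent-≥ (proj₁ ∘ pos) (proj₂ ∘ pos)
      (λ i j i≢j → monotone-separated pos drawing i≢j)) ,
    ⅙-scale {n = suc k} {m} n≤6m (extent-≥ (proj₂ ∘ pos) (proj₁ ∘ pos)
      (λ i j i≢j → separated-swap (proj₁ ∘ pos) (proj₂ ∘ pos) (monotone-separated pos drawing i≢j)))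
    where
    -- The `k` vertices other than the centre give each leg at least `m` edges; at most two vertices
    -- are left over.
    m = k ℕ./ 3
    open Spider k
    open Legs m (m/n*n≤m k 3)
    open ℕₚ.≤-Reasoning
    n≤6m : suc k ℕ.≤ 6 ℕ.* m
    n≤6m = begin
      suc k                      ≡⟨ cong suc (m≡m%n+[m/n]*n k 3) ⟩
      suc (k ℕ.% 3) ℕ.+ m ℕ.* 3  ≤⟨ ℕₚ.+-monoˡ-≤ (m ℕ.* 3) (m%n<n k 3) ⟩
      -- Since `m` is at least 1, the summand 3 is absorbed by a second `m ℕ.* 3`; this doubling
      -- turns one third into one sixth.
      3 ℕ.+ m ℕ.* 3              ≤⟨ ℕₚ.+-monoˡ-≤ (m ℕ.* 3) (ℕₚ.*-monoˡ-≤ 3 (m≥n⇒m/n>0 3≤k)) ⟩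
      m ℕ.* 3 ℕ.+ m ℕ.* 3        ≡⟨ ℕₚ.*-distribˡ-+ m 3 3 ⟨
      m ℕ.* 6                    ≡⟨ ℕₚ.*-comm m 6 ⟩
      6 ℕ.* m                    ∎
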